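{- Let $G$ be a cograph. The following procedure always returns a recursively minimal coloring of $G$: Let $(T_G,t_G)$ be the discriminating cotree of $G$. Initially assign pairwise distinct colors to all vertices of $G$. Then traverse the inner vertices $v$ of $T_G$ from bottom to top (every vertex after all its descendants); whenever $t_G(v)=0$, let $\mathcal{G}$ be the set of connected components of $G(v)$, choose $G^*\in\mathcal{G}$ with maximum chromatic number $\chi(G^*)$, set $S:=\sigma(V(G^*))$, and for every $G_j\in\mathcal{G}$ with $G_j\neq G^*$ choose (arbitrarily) an injective map $\phi:\sigma(V(G_j))\to S$ and replace $\sigma(x)$ by $\phi(\sigma(x))$ for all $x\in V(G_j)$; when $t_G(v)=1$ nothing is done. Moreover, every recursively minimal coloring of $G$ can be obtained as an output of this procedure for suitable choices made in it.
   Context: All graphs are finite, simple and undirected. A (proper vertex) coloring of $G=(V,E)$ is a surjective map $\sigma:V\to S$ with $\sigma(x)\neq\sigma(y)$ whenever $xy\in E$; $\chi(G)$ is the chromatic number. A cograph is a graph that is $K_1$, or a disjoint union of cographs, or a join of cographs. A cotree $(T,t)$ of a cograph $G$ is a rooted tree $T$ with leaf set $V$ and a labeling $t:V^0(T)\to\{0,1\}$ of its inner vertices such that for every inner vertex $u$, $G(u):=G[L(T(u))]$ (with $L(T(u))$ the leaves descending from $u$) is the disjoint union (if $t(u)=0$) or the join (if $t(u)=1$) of the graphs $G(v)$, $v$ a child of $u$. The discriminating cotree of $G$ is the unique cotree in which $t(u)\neq t(v)$ for every edge $uv$ of $T$ between two inner vertices. Color-minimal cographs are colored graphs $(G,\sigma)$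 ($\sigma$ a proper coloring) defined recursively: $(G,\sigma)$ is color-minimal if $|\sigma(V)|=\chi(G)$ and either $G=K_1$, or $G$ is the disjoint union, or the join, of at least two graphs $G_i$ such that each $(G_i,\sigma|_{V(G_i)})$ is a color-minimal cograph. A coloring $\sigma$ of $G$ is recursively minimal if $(G,\sigma)$ is a color-minimal cograph. -}

module Defs where

open import Level using (0ℓ)
open import Data.Nat using (ℕ; _+_; _≤_; _≟_)
open import Data.Fin using (Fin)
open import Data.Fin.Subset using (Subset; _∈_; _∉_; ⊤; ⁅_⁆; ⋃)
open import Data.Fin.Subset.Properties using (_∈?_)
open import Data.List using (List; []; _∷_; length; map; filter; deduplicate; allFin; tabulate; _++_)
open import Data.List.Relation.Unary.AllPairs using (AllPairs)
open import Data.List.Relation.Unary.Unique.Propositional using (Unique)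
import Data.List.Membership.Propositional as List
open import Data.Maybe using (Maybe; just; nothing)
open import Data.Product using (Σ; ∃; ∃-syntax; _×_)
import Data.Unit as Unit
open import Function.Bundles using (_⇔_)
open import Function.Definitions using (Injective)
open import Relation.Binary using (Rel; Decidable; Symmetric; Irreflexive)
open import Relation.Binary.Construct.Closure.ReflexiveTransitive using (Star)
open import Relation.Binary.PropositionalEquality using (_≡_; _≢_; _≗_)
open import Relation.Nullary using (¬_)

record Graph (n : ℕ) : Set₁ where
  field
    Adj    : Rel (Fin n) 0ℓ
    adj?   : Decidable Adj
    sym    : Symmetric Adj
    irrefl : Irreflexive _≡_ Adj

open Graph public using (Adj)

-- Every graph that occurs below is an induced subgraph G[U] of a fixed
-- graph G, and is represented by its vertex set U.

------------------------------------------------------------------------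
-- Colorings

-- The codomain of a coloring of G[U] is not recorded: it is the image σ(U).
Coloring : ℕ → Set
Coloring n = Fin n → ℕ

module _ {n : ℕ} where

  Proper : Graph n → Subset n → Coloring n → Set
  Proper G U σ = ∀ {x y} → x ∈ U → y ∈ U → Adj G x y → σ x ≢ σ y

  -- |σ(U)|
  numColors : Coloring n → Subset n → ℕ
  numColors σ U = length (deduplicate _≟_ (map σ (filter (_∈? U) (allFin n))))

  IsChromaticNumber : Graph n → Subset n → ℕ → Set
  IsChromaticNumber G U k =
      (∃[ σ ] Proper G U σ × numColors σ U ≡ k)
    × (∀ σ → Proper G U σ → k ≤ numColors σ U)

  -- χ(G[C]) ≤ χ(G[D])
  ChromaticNumber≤ : Graph n → Subset n → Subset n → Set
  ChromaticNumber≤ G C D =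
    ∃[ k ] ∃[ l ] IsChromaticNumber G C k × IsChromaticNumber G D l × k ≤ l

------------------------------------------------------------------------
-- Disjoint unions and joins; cographs and color-minimal cographs

-- As labels of a cotree, union stands for 0 and join for 1.
data Label : Set where
  union join : Label

module _ {n : ℕ} where

  IsPartition : ∀ {k} → Subset n → (Fin k → Subset n) → Set
  IsPartition U P =
      (∀ x → x ∈ U ⇔ (∃[ i ] x ∈ P i))
    × (∀ {x i j} → x ∈ P i → x ∈ P j → i ≡ j)

  CrossEdges : ∀ {k} → Label → Graph n → (Fin k → Subset n) → Set
  CrossEdges union G P = ∀ {i j x y} → i ≢ j → x ∈ P i → y ∈ P j → ¬ Adj G x y
  CrossEdges join  G P = ∀ {i j x y} → i ≢ j → x ∈ P i → y ∈ P j → Adj G x y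

  -- G[U] is the disjoint union, respectively the join, of the graphs G[P i].
  IsComposition : ∀ {k} → Label → Graph n → Subset n → (Fin k → Subset n) → Set
  IsComposition t G U P = IsPartition U P × CrossEdges t G P

  data IsCographOn (G : Graph n) (U : Subset n) : Set where
    K₁      : ∀ x → U ≡ ⁅ x ⁆ → IsCographOn G U
    compose : ∀ t {k} (P : Fin (2 + k) → Subset n) → IsComposition t G U P →
              (∀ i → IsCographOn G (P i)) → IsCographOn G U

  IsOptimal : Graph n → Coloring n → Subset n → Set
  IsOptimal G σ U = Proper G U σ × IsChromaticNumber G U (numColors σ U)

  data IsColorMinimalOn (G : Graph n) (σ : Coloring n) (U : Subset n) : Set where
    K₁      : IsOptimal G σ U → ∀ x → U ≡ ⁅ x ⁆ → IsColorMinimalOn G σ U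
    compose : IsOptimal G σ U →
              ∀ t {k} (P : Fin (2 + k) → Subset n) → IsComposition t G U P →
              (∀ i → IsColorMinimalOn G σ (P i)) → IsColorMinimalOn G σ U

  IsCograph : Graph n → Set
  IsCograph G = IsCographOn G ⊤

  IsRecursivelyMinimal : Graph n → Coloring n → Set
  IsRecursivelyMinimal G σ = IsColorMinimalOn G σ ⊤

------------------------------------------------------------------------
-- Connected components

module _ {n : ℕ} where

  Reachable : Graph n → Subset n → Rel (Fin n) 0ℓ
  Reachable G U = Star (λ x y → x ∈ U × y ∈ U × Adj G x y)

  IsComponent : Graph n → Subset n → Subset n → Set
  IsComponent G U C = ∃[ x ] x ∈ U × (∀ y → y ∈ C ⇔ Reachable G U x y)

------------------------------------------------------------------------
-- Cotrees

-- Inner vertices have at least two children; without this convention the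
-- discriminating cotree would not be unique.
data Cotree (n : ℕ) : Set where
  leaf : Fin n → Cotree n
  node : Label → ∀ {k} → (Fin (2 + k) → Cotree n) → Cotree n

module _ {n : ℕ} where

  leaves : Cotree n → Subset n
  leaves (leaf x)    = ⁅ x ⁆
  leaves (node t ts) = ⋃ (tabulate (λ i → leaves (ts i)))

  rootLabel : Cotree n → Maybe Label
  rootLabel (leaf _)   = nothing
  rootLabel (node t _) = just t

  -- Since the parts of a composition are disjoint, no vertex of G labels
  -- two different leaves.
  Explains : Cotree n → Graph n → Set
  Explains (leaf _)    G = Unit.⊤
  Explains (node t ts) G =
      IsComposition t G (leaves (node t ts)) (λ i → leaves (ts i))
    × (∀ i → Explains (ts i) G)

  IsCotree : Graph n → Cotree n → Set
  IsCotree G T = leaves T ≡ ⊤ × Explains T G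

  Alternating : Cotree n → Set
  Alternating (leaf _)    = Unit.⊤
  Alternating (node t ts) = ∀ i → rootLabel (ts i) ≢ just t × Alternating (ts i)

  IsDiscriminatingCotree : Graph n → Cotree n → Set
  IsDiscriminatingCotree G T = IsCotree G T × Alternating T

  data Inner : Cotree n → Set where
    here  : ∀ {t k} {ts : Fin (2 + k) → Cotree n} → Inner (node t ts)
    there : ∀ {t k} {ts : Fin (2 + k) → Cotree n} i → Inner (ts i) → Inner (node t ts)

  label : ∀ {T} → Inner T → Label
  label (here {t})  = t
  label (there _ u) = label u

  -- L(T(u))
  leavesBelow : ∀ {T} → Inner T → Subset n
  leavesBelow {T} here    = leaves T
  leavesBelow (there _ u) = leavesBelow u

  -- u ≺ v : u is a proper descendant of v.
  data _≺_ : ∀ {T} → Inner T → Inner T → Set where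
    there≺here  : ∀ {t k} {ts : Fin (2 + k) → Cotree n} {i} {u : Inner (ts i)} →
                  there {t} {k} {ts} i u ≺ here
    there≺there : ∀ {t k} {ts : Fin (2 + k) → Cotree n} {i} {u v : Inner (ts i)} →
                  u ≺ v → there {t} {k} {ts} i u ≺ there i v

  record IsBottomUp (T : Cotree n) (us : List (Inner T)) : Set where
    field
      complete : ∀ u → u List.∈ us
      unique   : Unique us
      -- if u comes before v in the list, then v is not a descendant of u
      ordered  : AllPairs (λ u v → ¬ (v ≺ u)) us

------------------------------------------------------------------------
-- The procedure

module _ {n : ℕ} where

  -- φ restricts to an injective map σ(C) → σ(D).
  IsInjectionOfColors : Coloring n → Subset n → Subset n → (ℕ → ℕ) → Set
  IsInjectionOfColors σ C D φ =
      (∀ {x} → x ∈ C → ∃[ y ] y ∈ D × φ (σ x) ≡ σ y)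
    × (∀ {x y} → x ∈ C → y ∈ C → φ (σ x) ≡ φ (σ y) → σ x ≡ σ y)

  IsMaximalComponent : Graph n → Subset n → Subset n → Set
  IsMaximalComponent G U C* =
    IsComponent G U C* × (∀ {C} → IsComponent G U C → ChromaticNumber≤ G C C*)

  -- τ arises from σ by recoloring the components of G[U] with the colors of C*.
  record Recoloring (G : Graph n) (U C* : Subset n) (σ τ : Coloring n) : Set where
    field
      recolored   : ∀ {C} → IsComponent G U C → C ≢ C* →
                    ∃[ φ ] IsInjectionOfColors σ C C* φ × (∀ {x} → x ∈ C → τ x ≡ φ (σ x))
      unchanged*  : ∀ {x} → x ∈ C* → τ x ≡ σ x
      unchanged   : ∀ {x} → x ∉ U → τ x ≡ σ x

  Process : Graph n → Label → Subset n → Rel (Coloring n) 0ℓ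
  Process G union U σ τ = ∃[ C* ] IsMaximalComponent G U C* × Recoloring G U C* σ τ
  Process G join  U σ τ = τ ≗ σ

  -- The choices asked for exist: there is a component to choose as G*, and
  -- whichever one is chosen, there are suitable injective maps φ.
  CanProcess : Graph n → Label → Subset n → Coloring n → Set
  CanProcess G union U σ =
      (∃[ C* ] IsMaximalComponent G U C*)
    × (∀ {C*} → IsMaximalComponent G U C* → ∃[ τ ] Recoloring G U C* σ τ)
  CanProcess G join  U σ = Unit.⊤

  data Run (G : Graph n) {T : Cotree n} : Coloring n → List (Inner T) → Coloring n → Set where
    []  : ∀ {σ} → Run G σ [] σ
    _∷_ : ∀ {σ ρ τ u us} → Process G (label u) (leavesBelow u) σ ρ → Run G ρ us τ →
          Run G σ (u ∷ us) τ

  IsOutput : Graph n → Cotree n → Coloring n → Set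
  IsOutput G T τ =
    ∃[ σ ] Σ (List (Inner T)) λ us → Injective _≡_ _≡_ σ × IsBottomUp T us × Run G σ us τ

  -- However the choices were made so far, the next vertex can be processed.
  NeverStuck : Graph n → Cotree n → Set
  NeverStuck G T =
    ∀ {σ ρ} (us : List (Inner T)) u vs → Injective _≡_ _≡_ σ → IsBottomUp T (us ++ u ∷ vs) →
    Run G σ us ρ → CanProcess G (label u) (leavesBelow u) ρ

{-# OPTIONS --safe #-}

-- Only the partition of the vertices into color classes matters: minimality
-- depends on nothing else, and a recoloring amounts to keeping the classes of
-- every component while using only colors of G*. Two invariants of a run are
-- that G(u) is color-minimal for every processed u, and that two vertices share
-- a color only below a common processed u. By the second, the children of a
-- join use disjoint sets of colors; at a disjoint union all colors occur in G*.
-- Hence every step preserves color-minimality.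
-- Conversely, a recursively minimal σ is minimal at every node of the cotree:
-- its decompositions may be binary or otherwise differ from the discriminating
-- ones, but no decomposition with label t splits a set that is t-indecomposable.
-- So at each disjoint union σ uses only colors of G*, and the recolorings can be
-- chosen to produce the color classes of σ. Renaming all colors of this run by
-- one injective map yields σ itself.
module Submission where

open import Data.Bool using () renaming (_≟_ to _≟ᵇ_)
open import Data.Fin using (Fin; zero; suc; toℕ) renaming (_≟_ to _≟ᶠ_)
open import Data.Fin.Properties using (any?; injective⇒≤; toℕ-injective)
open import Data.Fin.Subset using (Subset; _∈_; _∉_; _⊆_; Nonempty; ⊤; ⁅_⁆)
open import Data.Fin.Subset.Properties using (_∈?_; x∈⁅x⁆; x∈⁅y⁆⇒x≡y; ⊆-antisym; ∈⊤)
open import Data.List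
  using (List; []; _∷_; _∷ʳ_; _++_; length; lookup; map; filter; deduplicate; allFin; tabulate; concat)
open import Data.List.Extrema.Nat using (argmax; f[xs]≤f[argmax])
open import Data.List.Properties using (++-identityʳ; ∷ʳ-++)
import Data.List.Membership.Propositional as List
open import Data.List.Membership.Propositional.Properties
  using (∈-lookup; ∈-allFin; ∈-filter⁺; ∈-filter⁻; ∈-map⁺; ∈-map⁻; ∈-++⁺ˡ; ∈-++⁺ʳ
        ; ∈-++⁻; ∈-concat⁺′; ∈-tabulate⁺; ∈-deduplicate⁺; ∈-deduplicate⁻)
open import Data.List.Relation.Unary.All as All using (All; []; _∷_)
import Data.List.Relation.Unary.All.Properties as All
open import Data.List.Relation.Unary.AllPairs as AllPairs using (AllPairs; []; _∷_)
import Data.List.Relation.Unary.AllPairs.Properties as AllPairs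
open import Data.List.Relation.Unary.Any using (here; there)
open import Data.List.Relation.Unary.Any.Properties using (lookup-index)
open import Data.List.Relation.Unary.Unique.Propositional using (Unique)
open import Data.List.Relation.Unary.Unique.DecPropositional.Properties using (deduplicate-!)
open import Data.Maybe using (just)
open import Data.Nat using (ℕ; zero; suc; _+_; _≤_; s≤s; _≟_)
open import Data.Nat.Properties using (≤-trans; ≤-reflexive; 1+n≰n; m≤m+n; +-cancelˡ-≡)
open import Data.Product using (Σ-syntax; ∃-syntax; _×_; _,_; proj₁; proj₂)
open import Data.Sum using (_⊎_; inj₁; inj₂)
open import Data.Vec.Properties using (≡-dec)
open import Function using (_∘_; id)
open import Function.Bundles using (_⇔_; mk⇔; Equivalence)
open import Function.Definitions using (Injective)
import Function.Properties.Equivalence as ⇔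
open import Relation.Binary.Construct.Closure.ReflexiveTransitive using (ε; _◅_; gmap)
open import Relation.Binary.PropositionalEquality
  using (_≡_; _≢_; refl; sym; trans; cong; subst; _≗_)
open import Relation.Nullary using (¬_; Dec; yes; no; contradiction; _×-dec_)
open import Defs

open Equivalence using (to; from)

-- Injections between finite lists

lookup-injective : ∀ {A : Set} {xs : List A} → Unique xs →
                   ∀ {i j} → lookup xs i ≡ lookup xs j → i ≡ j
lookup-injective (_ ∷ _)  {zero}  {zero}  _  = refl
lookup-injective {xs = _ ∷ xs} (p ∷ _)  {zero}  {suc j} eq =
  contradiction eq (All.lookup p (∈-lookup j))
lookup-injective {xs = _ ∷ xs} (p ∷ _)  {suc i} {zero}  eq =
  contradiction (sym eq) (All.lookup p (∈-lookup i))
lookup-injective (_ ∷ ps) {suc i} {suc j} eq = cong suc (lookup-injective ps eq)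

injective⇒≤length : ∀ {A : Set} {m} {xs : List A} {f : Fin m → A} →
                    Injective _≡_ _≡_ f → (∀ i → f i List.∈ xs) → m ≤ length xs
injective⇒≤length {xs = xs} f-inj f∈ = injective⇒≤ λ {i} {j} eq →
  f-inj (trans (lookup-index (f∈ i))
        (trans (cong (lookup xs) eq) (sym (lookup-index (f∈ j)))))

length≤⇒injection : ∀ (xs ys : List ℕ) → Unique xs → Unique ys → length xs ≤ length ys →
  Σ[ φ ∈ (ℕ → ℕ) ] (∀ {a} → a List.∈ xs → φ a List.∈ ys)
       × (∀ {a b} → a List.∈ xs → b List.∈ xs → φ a ≡ φ b → a ≡ b)
length≤⇒injection [] ys _ _ _ = id , (λ ()) , λ ()
length≤⇒injection (x ∷ xs) (y ∷ ys) (x∉ ∷ uxs) (y∉ ∷ uys) (s≤s le)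
  with length≤⇒injection xs ys uxs uys le
... | φ , φ∈ , φ-inj = ψ , ψ∈ , ψ-inj
  where
  ψ : ℕ → ℕ
  ψ a with a ≟ x
  ... | yes _ = y
  ... | no  _ = φ a

  ψ∈ : ∀ {a} → a List.∈ x ∷ xs → ψ a List.∈ y ∷ ys
  ψ∈ {a} a∈ with a ≟ x | a∈
  ... | yes _  | _        = here refl
  ... | no a≢x | here a≡x = contradiction a≡x a≢x
  ... | no _   | there p  = there (φ∈ p)

  ψ-inj : ∀ {a b} → a List.∈ x ∷ xs → b List.∈ x ∷ xs → ψ a ≡ ψ b → a ≡ b
  ψ-inj {a} {b} a∈ b∈ eq with a ≟ x | b ≟ x | a∈ | b∈
  ... | yes a≡x | yes b≡x | _        | _        = trans a≡x (sym b≡x)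
  ... | yes _   | no b≢x  | _        | here b≡x = contradiction b≡x b≢x
  ... | yes _   | no _    | _        | there q  = contradiction eq (All.lookup y∉ (φ∈ q))
  ... | no a≢x  | _       | here a≡x | _        = contradiction a≡x a≢x
  ... | no _    | yes _   | there p  | _        = contradiction (sym eq) (All.lookup y∉ (φ∈ p))
  ... | no _    | no b≢x  | there _  | here b≡x = contradiction b≡x b≢x
  ... | no _    | no _    | there p  | there q  = φ-inj p q eq

abstract
  maximizer : ∀ {k} (f : Fin (suc k) → ℕ) → ∃[ i ] (∀ j → f j ≤ f i)
  maximizer f = argmax f zero (allFin _) ,
    λ j → All.lookup (f[xs]≤f[argmax] {f = f} zero (allFin _)) (∈-allFin j)

another : ∀ {k} (i : Fin (2 + k)) → ∃[ j ] i ≢ j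
another zero    = suc zero , λ ()
another (suc i) = zero , λ ()

_≟ˡ_ : ∀ (t t′ : Label) → Dec (t ≡ t′)
union ≟ˡ union = yes refl
union ≟ˡ join  = no λ ()
join  ≟ˡ union = no λ ()
join  ≟ˡ join  = yes refl

allPairs-++ : ∀ {A : Set} {R : A → A → Set} (xs : List A) {y ys} → AllPairs R (xs ++ y ∷ ys) →
              (∀ {x} → x List.∈ xs → R x y) × (∀ {z} → z List.∈ ys → R y z)
allPairs-++ []       (y~ ∷ _)  = (λ ()) , All.lookup y~
allPairs-++ (x ∷ xs) (x~ ∷ ps) with allPairs-++ xs ps
... | before , after = (λ { (here refl) → All.lookup x~ (∈-++⁺ʳ xs (here refl)) ; (there p) → before p })
                     , after

-- Colorings

module _ {n : ℕ} where

  colors : Coloring n → Subset n → List ℕ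
  colors σ U = deduplicate _≟_ (map σ (filter (_∈? U) (allFin n)))

  colors-! : ∀ (σ : Coloring n) (U : Subset n) → Unique (colors σ U)
  colors-! σ U = deduplicate-! _≟_ _

  abstract
    ∈-colors⁺ : ∀ (σ : Coloring n) (U : Subset n) {x} → x ∈ U → σ x List.∈ colors σ U
    ∈-colors⁺ σ U x∈U =
      ∈-deduplicate⁺ _≟_ (∈-map⁺ σ (∈-filter⁺ (_∈? U) (∈-allFin _) x∈U))

    ∈-colors⁻ : ∀ (σ : Coloring n) (U : Subset n) {c} → c List.∈ colors σ U → ∃[ x ] x ∈ U × c ≡ σ x
    ∈-colors⁻ σ U c∈ with ∈-map⁻ σ (∈-deduplicate⁻ _≟_ _ c∈)
    ... | x , x∈ , c≡ = x , proj₂ (∈-filter⁻ (_∈? U) {xs = allFin n} x∈) , c≡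

    -- Each color of `U` is given a representative, and the images of the representatives under `f`
    -- have pairwise distinct colors. As `f` acts on vertices, it may send equally colored vertices
    -- to differently colored ones.
    numColors-≤ : ∀ (σ τ : Coloring n) {U W : Subset n} (f : ∀ {x} → x ∈ U → ∃[ y ] y ∈ W) →
      (∀ {x y} (p : x ∈ U) (q : y ∈ U) → τ (proj₁ (f p)) ≡ τ (proj₁ (f q)) → σ x ≡ σ y) →
      numColors σ U ≤ numColors τ W
    numColors-≤ σ τ {U} {W} f f-inj =
      injective⇒≤length {xs = colors τ W} {f = g} g-inj (λ i → ∈-colors⁺ τ W (proj₂ (f (rep∈ i))))
      where
      rep : ∀ (i : Fin (numColors σ U)) → ∃[ x ] x ∈ U × lookup (colors σ U) i ≡ σ x
      rep i = ∈-colors⁻ σ U (∈-lookup i)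

      rep∈ : ∀ i → proj₁ (rep i) ∈ U
      rep∈ i = proj₁ (proj₂ (rep i))

      g : Fin (numColors σ U) → ℕ
      g i = τ (proj₁ (f (rep∈ i)))

      g-inj : Injective _≡_ _≡_ g
      g-inj {i} {j} eq = lookup-injective (colors-! σ U)
        (trans (proj₂ (proj₂ (rep i)))
        (trans (f-inj (rep∈ i) (rep∈ j) eq) (sym (proj₂ (proj₂ (rep j))))))

    -- Turns a comparison of cardinalities into a map of colors of the kind that a recoloring asks
    -- for.
    numColors-≤⇒injection : ∀ (σ τ : Coloring n) (U W : Subset n) → numColors σ U ≤ numColors τ W →
      Σ[ φ ∈ (ℕ → ℕ) ] (∀ {x} → x ∈ U → ∃[ y ] y ∈ W × φ (σ x) ≡ τ y)
           × (∀ {x y} → x ∈ U → y ∈ U → φ (σ x) ≡ φ (σ y) → σ x ≡ σ y)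
    numColors-≤⇒injection σ τ U W le
      with length≤⇒injection (colors σ U) (colors τ W) (colors-! σ U) (colors-! τ W) le
    ... | φ , φ∈ , φ-inj = φ , (λ p → ∈-colors⁻ τ W (φ∈ (∈-colors⁺ σ U p)))
                             , λ p q → φ-inj (∈-colors⁺ σ U p) (∈-colors⁺ σ U q)

    color-occurs? : ∀ (σ : Coloring n) (U : Subset n) c → Dec (∃[ x ] x ∈ U × c ≡ σ x)
    color-occurs? σ U c = any? λ x → (x ∈? U) ×-dec (c ≟ σ x)

    -- A color of `U` missing from `W` would, together with the colors of `W`, give more colors than
    -- `U` is allowed to have.
    numColors-≤⇒same-colors : ∀ (σ : Coloring n) (U W : Subset n) → W ⊆ U → numColors σ U ≤ numColors σ W →
      ∀ {x} → x ∈ U → ∃[ y ] y ∈ W × σ x ≡ σ y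
    numColors-≤⇒same-colors σ U W W⊆U le {x} x∈U with color-occurs? σ W (σ x)
    ... | yes p = p
    ... | no ¬p = contradiction
      (≤-trans (injective⇒≤length {xs = colors σ U} {f = f} f-inj f∈) le) 1+n≰n
      where
      f : Fin (suc (numColors σ W)) → ℕ
      f zero    = σ x
      f (suc i) = lookup (colors σ W) i

      new : ∀ i → σ x ≢ lookup (colors σ W) i
      new i eq with ∈-colors⁻ σ W (∈-lookup i)
      ... | y , y∈W , eq′ = ¬p (y , y∈W , trans eq eq′)

      f-inj : Injective _≡_ _≡_ f
      f-inj {zero}  {zero}  _  = refl
      f-inj {zero}  {suc j} eq = contradiction eq (new j)
      f-inj {suc i} {zero}  eq = contradiction (sym eq) (new i)
      f-inj {suc i} {suc j} eq = cong suc (lookup-injective (colors-! σ W) eq)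

      f∈ : ∀ i → f i List.∈ colors σ U
      f∈ zero    = ∈-colors⁺ σ U x∈U
      f∈ (suc i) with ∈-colors⁻ σ W (∈-lookup i)
      ... | y , y∈W , eq = subst (List._∈ colors σ U) (sym eq) (∈-colors⁺ σ U (W⊆U y∈W))

  numColors-mono : ∀ (σ : Coloring n) {U W : Subset n} → U ⊆ W → numColors σ U ≤ numColors σ W
  numColors-mono σ U⊆W = numColors-≤ σ σ (λ p → _ , U⊆W p) (λ _ _ → id)

  SameClasses : Coloring n → Coloring n → Subset n → Set
  SameClasses σ τ U = ∀ {x y} → x ∈ U → y ∈ U → σ x ≡ σ y ⇔ τ x ≡ τ y

  sameClasses-sym : ∀ {σ τ : Coloring n} {U : Subset n} → SameClasses σ τ U → SameClasses τ σ U
  sameClasses-sym s p q = ⇔.sym (s p q)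

  sameClasses-trans : ∀ {σ ρ τ : Coloring n} {U : Subset n} → SameClasses σ ρ U → SameClasses ρ τ U → SameClasses σ τ U
  sameClasses-trans s t p q = ⇔.trans (s p q) (t p q)

  sameClasses-⊆ : ∀ {σ τ : Coloring n} {U W : Subset n} → U ⊆ W → SameClasses σ τ W → SameClasses σ τ U
  sameClasses-⊆ U⊆W s p q = s (U⊆W p) (U⊆W q)

  ≗⇒sameClasses : ∀ {σ τ : Coloring n} {U : Subset n} → (∀ {x} → x ∈ U → σ x ≡ τ x) → SameClasses σ τ U
  ≗⇒sameClasses e p q = mk⇔ (λ eq → trans (sym (e p)) (trans eq (e q)))
                            (λ eq → trans (e p) (trans eq (sym (e q))))

  abstract
    -- Recovers the map of colors behind two colorings: its value at a color is read off at any
    -- vertex of `U` that has this color.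
    factor : ∀ {σ τ : Coloring n} {U : Subset n} → (∀ {x y} → x ∈ U → y ∈ U → σ x ≡ σ y → τ x ≡ τ y) →
             Σ[ φ ∈ (ℕ → ℕ) ] (∀ {x} → x ∈ U → τ x ≡ φ (σ x))
    factor {σ} {τ} {U} h = φ , φ-spec
      where
      φ : ℕ → ℕ
      φ c with color-occurs? σ U c
      ... | yes (x , _) = τ x
      -- For a color absent from `U` any value would do.
      ... | no  _       = c

      φ-spec : ∀ {x} → x ∈ U → τ x ≡ φ (σ x)
      φ-spec {x} x∈U with color-occurs? σ U (σ x)
      ... | yes (y , y∈U , eq) = h x∈U y∈U eq
      ... | no ¬p              = contradiction (x , x∈U , refl) ¬p

  -- Optimal colorings of joins and disjoint unions

  module _ {G : Graph n} where

    optimal : ∀ {σ : Coloring n} {U : Subset n} → Proper G U σ →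
              (∀ τ → Proper G U τ → numColors σ U ≤ numColors τ U) → IsOptimal G σ U
    optimal prop min = prop , (_ , prop , refl) , min

    sameClasses-optimal : ∀ {σ τ : Coloring n} {U : Subset n} → SameClasses σ τ U → IsOptimal G σ U → IsOptimal G τ U
    sameClasses-optimal s (prop , _ , min) = optimal
      (λ p q a eq → prop p q a (from (s p q) eq))
      λ π π-prop → ≤-trans (numColors-≤ _ _ (λ p → _ , p) (λ p q → to (s p q))) (min π π-prop)

    parts⊆ : ∀ {k U} {P : Fin k → Subset n} → IsPartition U P → ∀ i → P i ⊆ U
    parts⊆ (cover , _) i x∈ = from (cover _) (i , x∈)

    sameClasses-colorMinimal : ∀ {σ τ : Coloring n} {U : Subset n} → SameClasses σ τ U →
      IsColorMinimalOn G σ U → IsColorMinimalOn G τ U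
    sameClasses-colorMinimal s (K₁ opt x eq) = K₁ (sameClasses-optimal s opt) x eq
    sameClasses-colorMinimal s (compose opt t P comp min) =
      compose (sameClasses-optimal s opt) t P comp
        λ i → sameClasses-colorMinimal (sameClasses-⊆ (parts⊆ (proj₁ comp) i) s) (min i)

    colorMinimal⇒optimal : ∀ {σ : Coloring n} {U : Subset n} → IsColorMinimalOn G σ U → IsOptimal G σ U
    colorMinimal⇒optimal (K₁ opt _ _)          = opt
    colorMinimal⇒optimal (compose opt _ _ _ _) = opt

    singleton-colorMinimal : ∀ σ {U} x → U ≡ ⁅ x ⁆ → IsColorMinimalOn G σ U
    singleton-colorMinimal σ x refl = K₁ (optimal
        (λ p q a _ → Graph.irrefl G (≡x p q) a)
        λ τ _ → numColors-≤ σ τ (λ p → _ , p) (λ p q _ → cong σ (≡x p q))) x refl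
      where
      ≡x : ∀ {y z} → y ∈ ⁅ x ⁆ → z ∈ ⁅ x ⁆ → y ≡ z
      ≡x p q = trans (x∈⁅y⁆⇒x≡y x p) (sym (x∈⁅y⁆⇒x≡y x q))

    abstract
      -- A proper coloring `τ` of a join uses disjoint color sets on the parts. The injections from
      -- the colors of `ρ` on each part into those of `τ` on that part therefore combine to one
      -- injection, and no cardinalities have to be added.
      join-optimal : ∀ {ρ k U} {P : Fin k → Subset n} → IsComposition join G U P →
        (∀ i → IsOptimal G ρ (P i)) →
        (∀ {i j x y} → i ≢ j → x ∈ P i → y ∈ P j → ρ x ≢ ρ y) → IsOptimal G ρ U
      join-optimal {ρ} {U = U} {P} comp@((cover , _) , cross) opt distinct = optimal prop min
        where
        part : ∀ {x} → x ∈ U → ∃[ i ] x ∈ P i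
        part = to (cover _)

        prop : Proper G U ρ
        prop p q a eq with part p | part q
        ... | i , p′ | j , q′ with i ≟ᶠ j
        ... | yes refl = proj₁ (opt i) p′ q′ a eq
        ... | no i≢j   = distinct i≢j p′ q′ eq

        min : ∀ τ → Proper G U τ → numColors ρ U ≤ numColors τ U
        min τ τ-prop = numColors-≤ ρ τ choice choice-inj
          where
          injection : ∀ i → Σ[ φ ∈ (ℕ → ℕ) ] (∀ {x} → x ∈ P i → ∃[ y ] y ∈ P i × φ (ρ x) ≡ τ y)
                      × (∀ {x y} → x ∈ P i → y ∈ P i → φ (ρ x) ≡ φ (ρ y) → ρ x ≡ ρ y)
          injection i = numColors-≤⇒injection ρ τ (P i) (P i)
            (proj₂ (proj₂ (opt i)) τ λ p q → τ-prop (parts⊆ (proj₁ comp) i p) (parts⊆ (proj₁ comp) i q))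

          image : ∀ {i x} → x ∈ P i → ∃[ y ] y ∈ P i × proj₁ (injection i) (ρ x) ≡ τ y
          image {i} = proj₁ (proj₂ (injection i))

          image∈ : ∀ {i x} (p : x ∈ P i) → proj₁ (image p) ∈ P i
          image∈ p = proj₁ (proj₂ (image p))

          image-inj : ∀ {i j x y} (p : x ∈ P i) (q : y ∈ P j) →
                      τ (proj₁ (image p)) ≡ τ (proj₁ (image q)) → ρ x ≡ ρ y
          image-inj {i} {j} p q eq with i ≟ᶠ j
          ... | yes refl = proj₂ (proj₂ (injection i)) p q
            (trans (proj₂ (proj₂ (image p))) (trans eq (sym (proj₂ (proj₂ (image q))))))
          ... | no i≢j   = contradiction eq
            (τ-prop (parts⊆ (proj₁ comp) i (image∈ p)) (parts⊆ (proj₁ comp) j (image∈ q))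
                    (cross i≢j (image∈ p) (image∈ q)))

          choice : ∀ {x} → x ∈ U → ∃[ y ] y ∈ U
          choice p = let i , q = part p ; y , y∈ , _ = image q in y , parts⊆ (proj₁ comp) i y∈

          choice-inj : ∀ {x y} (p : x ∈ U) (q : y ∈ U) →
                       τ (proj₁ (choice p)) ≡ τ (proj₁ (choice q)) → ρ x ≡ ρ y
          choice-inj p q = image-inj (proj₂ (part p)) (proj₂ (part q))

      -- All colors already occur on the part `P i*`, where no proper coloring uses fewer, and
      -- passing to the larger set `U` cannot lower the number for a competitor.
      union-optimal : ∀ {τ k U} {P : Fin k → Subset n} → IsComposition union G U P →
        (∀ i → IsOptimal G τ (P i)) →
        ∀ i* → (∀ {x} → x ∈ U → ∃[ y ] y ∈ P i* × τ x ≡ τ y) → IsOptimal G τ U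
      union-optimal {τ} {U = U} {P} comp@((cover , _) , cross) opt i* same = optimal prop min
        where
        prop : Proper G U τ
        prop p q a eq with to (cover _) p | to (cover _) q
        ... | i , p′ | j , q′ with i ≟ᶠ j
        ... | yes refl = proj₁ (opt i) p′ q′ a eq
        ... | no i≢j   = cross i≢j p′ q′ a

        min : ∀ π → Proper G U π → numColors τ U ≤ numColors π U
        min π π-prop = ≤-trans
          (numColors-≤ τ τ (λ p → let y , y∈ , _ = same p in y , y∈)
            λ p q eq → trans (proj₂ (proj₂ (same p))) (trans eq (sym (proj₂ (proj₂ (same q))))))
          (≤-trans (proj₂ (proj₂ (opt i*)) π λ p q → π-prop (parts⊆ (proj₁ comp) i* p) (parts⊆ (proj₁ comp) i* q))
            (numColors-mono π (parts⊆ (proj₁ comp) i*)))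

      -- The coloring of `C` with `k` colors shows that `ρ` has at most `k` colors there, and `ρ`
      -- has at least `l` colors on `D`.
      chromaticNumber-≤ : ∀ (ρ : Coloring n) (C D : Subset n) → IsOptimal G ρ C → IsOptimal G ρ D →
                          ChromaticNumber≤ G C D → numColors ρ C ≤ numColors ρ D
      chromaticNumber-≤ ρ C D (_ , _ , minC) (propD , _) (k , l , ((σ , σ-prop , σ-eq) , _) , (_ , minl) , k≤l) =
        ≤-trans (minC σ σ-prop) (≤-trans (≤-reflexive σ-eq) (≤-trans k≤l (minl ρ propD)))

      glue : ∀ {k U} {P : Fin k → Subset n} → IsPartition U P →
        (f : Fin k → Coloring n) (g : Coloring n) →
        Σ[ τ ∈ Coloring n ] (∀ {i x} → x ∈ P i → τ x ≡ f i x) × (∀ {x} → x ∉ U → τ x ≡ g x)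
      glue {k = k} {U} {P} part@(cover , disjoint) f g = τ , inside , outside
        where
        τ : Coloring n
        τ x with x ∈? U
        ... | yes p = f (proj₁ (to (cover x) p)) x
        ... | no  _ = g x

        inside : ∀ {i x} → x ∈ P i → τ x ≡ f i x
        inside {i} {x} q with x ∈? U
        ... | yes p = cong (λ j → f j x) (disjoint (proj₂ (to (cover x) p)) q)
        ... | no ¬p = contradiction (parts⊆ part i q) ¬p

        outside : ∀ {x} → x ∉ U → τ x ≡ g x
        outside {x} ¬p with x ∈? U
        ... | yes p = contradiction p ¬p
        ... | no  _ = refl

-- Connected components of a disjoint union

    module Components {k U} {P : Fin (2 + k) → Subset n} (comp : IsComposition union G U P)
      (nonempty : ∀ i → Nonempty (P i))
      (connected : ∀ i {x y} → x ∈ P i → y ∈ P i → Reachable G (P i) x y) where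

      private
        cover = proj₁ (proj₁ comp)
        cross = proj₂ comp

      reachable-stays : ∀ {i x y} → x ∈ P i → Reachable G U x y → y ∈ P i
      reachable-stays p ε = p
      reachable-stays {i} p ((_ , z∈U , a) ◅ r) with to (cover _) z∈U
      ... | j , q with i ≟ᶠ j
      ... | yes refl = reachable-stays q r
      ... | no i≢j   = contradiction a (cross i≢j p q)

      -- No edge leaves a part, so a walk in `U` stays in the part where it starts; the converse is
      -- connectedness. Hence parts and components can be exchanged for each other.
      part⇔reachable : ∀ {i x} → x ∈ P i → ∀ y → y ∈ P i ⇔ Reachable G U x y
      part⇔reachable {i} p y = mk⇔
        (λ q → gmap id (λ (r , s , a) → parts⊆ (proj₁ comp) i r , parts⊆ (proj₁ comp) i s , a) (connected i p q))
        (reachable-stays p)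

      part-component : ∀ i → IsComponent G U (P i)
      part-component i with nonempty i
      ... | x , p = x , parts⊆ (proj₁ comp) i p , part⇔reachable p

      component-part : ∀ {C} → IsComponent G U C → ∃[ i ] C ≡ P i
      component-part (x , x∈U , C⇔) with to (cover x) x∈U
      ... | i , p = i , ⊆-antisym (λ q → from (part⇔reachable p _) (to (C⇔ _) q))
                                  (λ q → from (C⇔ _) (to (part⇔reachable p _) q))

      recoloring-classes : ∀ {C* σ τ} → Recoloring G U C* σ τ → ∀ i → SameClasses σ τ (P i)
      recoloring-classes {C*} r i with ≡-dec _≟ᵇ_ (P i) C*
      ... | yes refl = ≗⇒sameClasses λ p → sym (Recoloring.unchanged* r p)
      ... | no P≢C* with Recoloring.recolored r (part-component i) P≢C*
      ... | φ , (_ , φ-inj) , τ≡ = λ p q → mk⇔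
        (λ eq → trans (τ≡ p) (trans (cong φ eq) (sym (τ≡ q))))
        (λ eq → φ-inj p q (trans (sym (τ≡ p)) (trans eq (τ≡ q))))

      recoloring-image : ∀ {C* σ τ} → Recoloring G U C* σ τ →
                         ∀ {x} → x ∈ U → ∃[ y ] y ∈ C* × τ x ≡ σ y
      recoloring-image {C*} r {x} x∈U with to (cover x) x∈U
      ... | i , p with ≡-dec _≟ᵇ_ (P i) C*
      ... | yes refl = x , p , Recoloring.unchanged* r p
      ... | no P≢C* with Recoloring.recolored r (part-component i) P≢C*
      ... | φ , (φ∈ , _) , τ≡ with φ∈ p
      ... | y , y∈ , eq = y , y∈ , trans (τ≡ p) eq

      -- The maps of colors are read off from `σ` and `τ`: they exist because equal colors within a
      -- part stay equal, and are injective because different colors stay different.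
      recoloring : ∀ {i* σ τ} → (∀ i → SameClasses σ τ (P i)) →
        (∀ {i x} → x ∈ P i → ∃[ y ] y ∈ P i* × τ x ≡ σ y) →
        (∀ {x} → x ∈ P i* → τ x ≡ σ x) → (∀ {x} → x ∉ U → τ x ≡ σ x) →
        Recoloring G U (P i*) σ τ
      recoloring {i*} {σ} {τ} classes image fixed* fixed = record
        { recolored = recolored ; unchanged* = fixed* ; unchanged = fixed }
        where
        recolored : ∀ {C} → IsComponent G U C → C ≢ P i* →
          ∃[ φ ] IsInjectionOfColors σ C (P i*) φ × (∀ {x} → x ∈ C → τ x ≡ φ (σ x))
        recolored c _ with component-part c
        ... | i , refl with factor {σ} {τ} (λ p q → to (classes i p q))
        ... | φ , τ≡ = φ
          , ( (λ p → let y , y∈ , eq = image p in y , y∈ , trans (sym (τ≡ p)) eq)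
            , λ p q eq → from (classes i p q) (trans (τ≡ p) (trans eq (sym (τ≡ q)))))
          , τ≡

      -- On `P i*` the current coloring `ρ` is `φ ∘ σ`, with `φ` injective on the colors of `σ`
      -- there. As `σ` has no further colors on `U`, applying `φ ∘ σ` to all of `U` reproduces the
      -- classes of `σ`.
      recoloring-following : ∀ {i* σ ρ} → (∀ i → SameClasses σ ρ (P i)) →
        (∀ {x} → x ∈ U → ∃[ y ] y ∈ P i* × σ x ≡ σ y) →
        ∃[ τ ] Recoloring G U (P i*) ρ τ × SameClasses σ τ U
      recoloring-following {i*} {σ} {ρ} classes same = τ , recoloring
          (λ i → sameClasses-trans (sameClasses-sym (classes i))
                                   (sameClasses-⊆ (parts⊆ (proj₁ comp) i) followed))
          (λ p → let y , y∈ , eq = image (parts⊆ (proj₁ comp) _ p) in y , y∈ , proj₁ eq)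
          (λ p → trans (inside p) (sym (ρ≡ p)))
          outside
        , followed
        where
        factored = factor {σ} {ρ} {P i*} (λ p q → to (classes i* p q))
        φ        = proj₁ factored
        ρ≡       = λ {x} → proj₂ factored {x}

        glued   = glue (proj₁ comp) (λ _ → φ ∘ σ) ρ
        τ       = proj₁ glued
        inside  = λ {i} {x} → proj₁ (proj₂ glued) {i} {x}
        outside = λ {x} → proj₂ (proj₂ glued) {x}

        image : ∀ {x} → x ∈ U → ∃[ y ] y ∈ P i* × τ x ≡ ρ y × σ x ≡ σ y
        image p = let y , y∈ , eq = same p in
          y , y∈ , trans (inside (proj₂ (to (cover _) p))) (trans (cong φ eq) (sym (ρ≡ y∈))) , eq

        followed : SameClasses σ τ U
        followed p q with image p | image q
        ... | y , y∈ , τ≡ , σ≡ | y′ , y′∈ , τ≡′ , σ≡′ = ⇔.trans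
          (mk⇔ (λ eq → trans (sym σ≡) (trans eq σ≡′)) (λ eq → trans σ≡ (trans eq (sym σ≡′))))
          (⇔.trans (classes i* y∈ y′∈)
          (mk⇔ (λ eq → trans τ≡ (trans eq (sym τ≡′))) (λ eq → trans (sym τ≡) (trans eq τ≡′))))

      recoloring-exists : ∀ {ρ i*} → (∀ i → numColors ρ (P i) ≤ numColors ρ (P i*)) →
                          ∃[ τ ] Recoloring G U (P i*) ρ τ
      recoloring-exists {ρ} {i*} le = τ , recoloring
          (λ i p q → mk⇔
            (λ eq → trans (inside p) (trans (cong (φ i) eq) (sym (inside q))))
            (λ eq → φ-inj i p q (trans (sym (inside p)) (trans eq (inside q)))))
          (λ p → let y , y∈ , eq = φ∈ _ p in y , y∈ , trans (inside p) eq)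
          (λ p → trans (inside p) (proj₂ (proj₂ (injection i*)) refl))
          outside
        where
        injection : ∀ i → Σ[ φ ∈ (ℕ → ℕ) ] IsInjectionOfColors ρ (P i) (P i*) φ
                        × (∀ {x} → i ≡ i* → φ (ρ x) ≡ ρ x)
        injection i with i ≟ᶠ i*
        -- The chosen part must keep its colors, so it gets the identity and not an arbitrary
        -- injection.
        ... | yes refl = id , ((λ p → _ , p , refl) , (λ _ _ → id)) , λ _ → refl
        ... | no i≢i*  with numColors-≤⇒injection ρ ρ (P i) (P i*) (le i)
        ... | φ , inj = φ , inj , λ eq → contradiction eq i≢i*

        φ     = λ i → proj₁ (injection i)
        φ∈    = λ i {x} → proj₁ (proj₁ (proj₂ (injection i))) {x}
        φ-inj = λ i {x} {y} → proj₂ (proj₁ (proj₂ (injection i))) {x} {y}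

        glued   = glue (proj₁ comp) (λ i → φ i ∘ ρ) ρ
        τ       = proj₁ glued
        inside  = λ {i} {x} → proj₁ (proj₂ glued) {i} {x}
        outside = λ {x} → proj₂ (proj₂ glued) {x}

      -- Optimality identifies chromatic numbers with numbers of colors of `ρ`. A part with most
      -- colors is thus a maximal component, and any maximal component has enough colors to receive
      -- every other one.
      canProcess : ∀ {ρ} → (∀ i → IsOptimal G ρ (P i)) → CanProcess G union U ρ
      canProcess {ρ} opt = (P i* , part-component i* , maximal) , λ {C*} → recolor {C*}
        where
        largest : ∃[ i ] (∀ j → numColors ρ (P j) ≤ numColors ρ (P i))
        largest = maximizer λ i → numColors ρ (P i)

        i* = proj₁ largest

        maximal : ∀ {C} → IsComponent G U C → ChromaticNumber≤ G C (P i*)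
        maximal c with component-part c
        ... | i , refl = numColors ρ (P i) , numColors ρ (P i*) , proj₂ (opt i) , proj₂ (opt i*) , proj₂ largest i

        recolor : ∀ {C*} → IsMaximalComponent G U C* → ∃[ τ ] Recoloring G U C* ρ τ
        recolor (c* , max) with component-part c*
        ... | j , refl = recoloring-exists λ i →
          chromaticNumber-≤ ρ (P i) (P j) (opt i) (opt j) (max (part-component i))

      -- Recoloring `σ` itself from a largest component `P i*` gives an optimal coloring of `U` with
      -- at most as many colors as `σ` has on `P i*`. Since `σ` is optimal too, it has no color on
      -- `U` beyond those of `P i*`.
      optimal⇒same-colors : ∀ {σ} → (∀ i → IsOptimal G σ (P i)) → IsOptimal G σ U →
        ∃[ i* ] IsMaximalComponent G U (P i*) × (∀ {x} → x ∈ U → ∃[ y ] y ∈ P i* × σ x ≡ σ y)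
      optimal⇒same-colors {σ} opt (_ , _ , min) with canProcess opt
      ... | (C* , C*-max) , recolor with component-part (proj₁ C*-max)
      ... | i* , refl with recolor C*-max
      ... | τ , r = i* , C*-max , numColors-≤⇒same-colors σ U (P i*) (parts⊆ (proj₁ comp) i*)
        (≤-trans (min τ (proj₁ τ-optimal)) (numColors-≤ τ σ
          (λ p → let y , y∈ , _ = recoloring-image r p in y , y∈)
          λ p q eq → trans (proj₂ (proj₂ (recoloring-image r p)))
                    (trans eq (sym (proj₂ (proj₂ (recoloring-image r q)))))))
        where
        τ-optimal : IsOptimal G τ U
        τ-optimal = union-optimal comp
          (λ i → sameClasses-optimal (recoloring-classes r i) (opt i)) i*
          λ p → let y , y∈ , eq = recoloring-image r p in
                y , y∈ , trans eq (sym (Recoloring.unchanged* r y∈))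

-- Decompositions of color-minimal cographs

    CrossEdge : Label → Fin n → Fin n → Set
    CrossEdge union x y = ¬ Adj G x y
    CrossEdge join  x y = Adj G x y

    crossEdge : ∀ {k} {P : Fin k → Subset n} t → CrossEdges t G P →
                ∀ {i j x y} → i ≢ j → x ∈ P i → y ∈ P j → CrossEdge t x y
    crossEdge union cross = cross
    crossEdge join  cross = cross

    crossEdge-unique : ∀ t t′ {x y} → CrossEdge t x y → CrossEdge t′ x y → t ≡ t′
    crossEdge-unique union union _ _ = refl
    crossEdge-unique union join  a b = contradiction b a
    crossEdge-unique join  union a b = contradiction a b
    crossEdge-unique join  join  _ _ = refl

    -- U ∩ D and U ∖ D form no composition of G[U] with label t, unless one of them is empty.
    Indecomposable : Label → Subset n → Set
    Indecomposable t U = ∀ D →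
      (∀ {x y} → x ∈ U → x ∈ D → y ∈ U → y ∉ D → CrossEdge t x y) →
      ∀ {x} → x ∈ U → x ∈ D → U ⊆ D

    singleton-indecomposable : ∀ {t} x → Indecomposable t ⁅ x ⁆
    singleton-indecomposable x D _ p q r =
      subst (_∈ D) (trans (x∈⁅y⁆⇒x≡y x p) (sym (x∈⁅y⁆⇒x≡y x r))) q

    -- Joins are connected and disjoint unions have connected complements, so neither splits with
    -- the other label.
    composition-indecomposable : ∀ {t t′ k U} {P : Fin (2 + k) → Subset n} →
      IsComposition t′ G U P → (∀ i → Nonempty (P i)) → t ≢ t′ → Indecomposable t U
    composition-indecomposable {t} {t′} {U = U} {P} comp@((cover , _) , cross) ne t≢t′ D sep {x} x∈U x∈D {y} y∈U
      with y ∈? D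
    ... | yes y∈D = y∈D
    ... | no  y∉D with to (cover x) x∈U | to (cover y) y∈U
    ... | i , p | j , q with i ≟ᶠ j
    ... | no i≢j = contradiction
      (crossEdge-unique t t′ (sep x∈U x∈D y∈U y∉D) (crossEdge t′ cross i≢j p q)) t≢t′
    -- With both vertices in one part, a vertex `z` of another part is related to both by the label
    -- `t′`, while `D` separates `z` from one of them.
    ... | yes refl with another i
    ... | l , i≢l with ne l
    ... | z , r with z ∈? D
    ... | yes z∈D = contradiction
      (crossEdge-unique t t′ (sep (parts⊆ (proj₁ comp) l r) z∈D y∈U y∉D) (crossEdge t′ cross (i≢l ∘ sym) r q)) t≢t′
    ... | no  z∉D = contradiction
      (crossEdge-unique t t′ (sep x∈U x∈D (parts⊆ (proj₁ comp) l r) z∉D) (crossEdge t′ cross i≢l p r)) t≢t′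

    colorMinimal-nonempty : ∀ {σ : Coloring n} {U : Subset n} → IsColorMinimalOn G σ U → Nonempty U
    colorMinimal-nonempty (K₁ _ x refl) = x , x∈⁅x⁆ x
    colorMinimal-nonempty (compose _ _ _ comp min) =
      let x , p = colorMinimal-nonempty (min zero) in x , parts⊆ (proj₁ comp) zero p

    -- A t-indecomposable C lies within one part of any decomposition with label
    -- t, and a decomposition with the other label makes U itself t-indecomposable,
    -- so that C = U.
    colorMinimal-component : ∀ {σ t U C} → IsColorMinimalOn G σ U → C ⊆ U → Nonempty C →
      Indecomposable t C → (∀ {x y} → x ∈ C → y ∈ U → y ∉ C → CrossEdge t x y) →
      IsColorMinimalOn G σ C
    colorMinimal-component {σ} (K₁ _ x refl) C⊆U (z , z∈C) _ _ =
      singleton-colorMinimal σ x (⊆-antisym C⊆U λ p →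
        subst (_∈ _) (trans (x∈⁅y⁆⇒x≡y x (C⊆U z∈C)) (sym (x∈⁅y⁆⇒x≡y x p))) z∈C)
    colorMinimal-component {σ} {t} {U} {C} m@(compose _ t′ Q comp@((cover , disjoint) , cross) min) C⊆U (z , z∈C) indec sep
      with t ≟ˡ t′
    ... | no t≢t′ = subst (IsColorMinimalOn G σ)
      (⊆-antisym
        (composition-indecomposable comp (λ i → colorMinimal-nonempty (min i)) t≢t′ C
          (λ _ p q r → sep p q r) (C⊆U z∈C) z∈C)
        C⊆U) m
    ... | yes refl with to (cover z) (C⊆U z∈C)
    ... | i , z∈Q = colorMinimal-component {t = t} (min i) C⊆Q (z , z∈C) indec
                      (λ p q r → sep p (parts⊆ (proj₁ comp) i q) r)
      where
      C⊆Q : C ⊆ Q i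
      C⊆Q = indec (Q i) across z∈C z∈Q
        where
        across : ∀ {x y} → x ∈ C → x ∈ Q i → y ∈ C → y ∉ Q i → CrossEdge t x y
        across _ p q ¬r with to (cover _) (C⊆U q)
        ... | j , r = crossEdge t cross (λ { refl → ¬r r }) p r

-- Renaming the colors of a run

    process-≗ : ∀ t {U ρ τ τ′} → Process G t U ρ τ → τ ≗ τ′ → Process G t U ρ τ′
    process-≗ union (C* , C*-max , r) e = C* , C*-max , record
      { recolored   = λ c ≢C* → let φ , inj , τ≡ = recolored c ≢C* in
                                φ , inj , λ p → trans (sym (e _)) (τ≡ p)
      ; unchanged*  = λ p → trans (sym (e _)) (unchanged* p)
      ; unchanged   = λ p → trans (sym (e _)) (unchanged p) }
      where open Recoloring r
    process-≗ join τ≗ρ e x = trans (sym (e x)) (τ≗ρ x)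

    -- The map `φ` of a component becomes its conjugate by `π` on the renamed colors; `factor`
    -- provides it without an inverse of `π`.
    process-rename : ∀ {π} → Injective _≡_ _≡_ π → ∀ t {U ρ τ} →
                     Process G t U ρ τ → Process G t U (π ∘ ρ) (π ∘ τ)
    process-rename {π} π-inj union {U} {ρ} {τ} (C* , C*-max , r) = C* , C*-max , record
      { recolored   = renamed
      ; unchanged*  = λ p → cong π (unchanged* p)
      ; unchanged   = λ p → cong π (unchanged p) }
      where
      open Recoloring r
      renamed : ∀ {C} → IsComponent G U C → C ≢ C* →
        ∃[ φ ] IsInjectionOfColors (π ∘ ρ) C C* φ × (∀ {x} → x ∈ C → π (τ x) ≡ φ (π (ρ x)))
      renamed {C} c ≢C* with recolored c ≢C*
      ... | φ , (φ∈ , φ-inj) , τ≡ with factor {π ∘ ρ} {π ∘ τ} {C}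
              (λ p q eq → cong π (trans (τ≡ p) (trans (cong φ (π-inj eq)) (sym (τ≡ q)))))
      ... | ψ , ψ≡ = ψ
        , ( (λ p → let y , y∈ , eq = φ∈ p in
                   y , y∈ , trans (sym (ψ≡ p)) (cong π (trans (τ≡ p) eq)))
          , λ p q eq → cong π (φ-inj p q (trans (sym (τ≡ p))
              (trans (π-inj (trans (ψ≡ p) (trans eq (sym (ψ≡ q))))) (τ≡ q)))))
        , ψ≡
    process-rename {π} π-inj join τ≗ρ x = cong π (τ≗ρ x)

    module _ {T : Cotree n} where

      -- A run without steps returns its initial coloring itself, so a pointwise equal result can be
      -- substituted only after at least one step.
      run-≗ : ∀ {ρ τ τ′} {u : Inner T} {us} → Run G ρ (u ∷ us) τ → τ ≗ τ′ → Run G ρ (u ∷ us) τ′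
      run-≗ {u = u} (p ∷ [])      e = process-≗ (label u) p e ∷ []
      run-≗         (p ∷ (q ∷ r)) e = p ∷ run-≗ (q ∷ r) e

      run-rename : ∀ {π} → Injective _≡_ _≡_ π → ∀ {ρ τ} {us : List (Inner T)} →
                   Run G ρ us τ → Run G (π ∘ ρ) us (π ∘ τ)
      run-rename π-inj []                = []
      run-rename π-inj (_∷_ {u = u} p r) = process-rename π-inj (label u) p ∷ run-rename π-inj r

  bounded : ∀ {m} (f : Fin m → ℕ) → ∃[ b ] (∀ i → f i ≤ b)
  bounded {zero}  f = 0 , λ ()
  bounded {suc _} f = let i , max = maximizer f in f i , max

  -- The common classes determine `π` on the colors of `τ`. Injectivity on all of `ℕ`, which the
  -- renaming of a run requires, is achieved by moving the remaining colors above every value of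
  -- `σ`.
  renaming-exists : ∀ {σ τ : Coloring n} → SameClasses σ τ ⊤ →
                    Σ[ π ∈ (ℕ → ℕ) ] Injective _≡_ _≡_ π × (π ∘ τ ≗ σ)
  renaming-exists {σ} {τ} same = π , π-inj , π-spec
    where
    b = proj₁ (bounded σ)

    fresh : ∀ {x c} → σ x ≢ suc (b + c)
    fresh {x} {c} eq = 1+n≰n (≤-trans (≤-reflexive (sym eq))
                             (≤-trans (proj₂ (bounded σ) x) (m≤m+n b c)))

    π : ℕ → ℕ
    π c with color-occurs? τ ⊤ c
    ... | yes (x , _) = σ x
    ... | no  _       = suc (b + c)

    π-inj : Injective _≡_ _≡_ π
    π-inj {c} {d} eq with color-occurs? τ ⊤ c | color-occurs? τ ⊤ d
    ... | yes (x , _ , ex) | yes (y , _ , ey) =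
      trans ex (trans (to (same ∈⊤ ∈⊤) eq) (sym ey))
    ... | yes (x , _)      | no _             = contradiction eq fresh
    ... | no _             | yes (y , _)      = contradiction (sym eq) fresh
    ... | no _             | no _             = +-cancelˡ-≡ (suc b) c d eq

    π-spec : π ∘ τ ≗ σ
    π-spec x with color-occurs? τ ⊤ (τ x)
    ... | yes (y , _ , eq) = from (same ∈⊤ ∈⊤) (sym eq)
    ... | no ¬p            = contradiction (x , ∈⊤ , refl) ¬p

-- Inner vertices of a cotree

  ≺-irrefl : ∀ {T : Cotree n} {u : Inner T} → ¬ (u ≺ u)
  ≺-irrefl (there≺there p) = ≺-irrefl p

  root : ∀ (T : Cotree n) → (∃[ x ] leaves T ≡ ⁅ x ⁆) ⊎
         (Σ[ v ∈ Inner T ] leavesBelow v ≡ leaves T × rootLabel T ≡ just (label v))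
  root (leaf x)    = inj₁ (x , refl)
  root (node t ts) = inj₂ (here , refl , refl)

  -- The alternation of labels is recorded at an inner child, for it makes the part indecomposable
  -- for the label of `u`, and connected when `u` is a union.
  data Child {T : Cotree n} (u : Inner T) (C : Subset n) : Set where
    leaf  : ∀ x → C ≡ ⁅ x ⁆ → Child u C
    inner : ∀ v → v ≺ u → C ≡ leavesBelow v → label v ≢ label u → Child u C

  data Position {T : Cotree n} (u v : Inner T) : Set where
    same     : u ≡ v → Position u v
    below    : u ≺ v → Position u v
    above    : v ≺ u → Position u v
    disjoint : (∀ {x} → x ∈ leavesBelow u → x ∉ leavesBelow v) → Position u v

  module _ {G : Graph n} where

    -- Describes the children of `u` by vertex sets and by inner vertices of the whole tree, which
    -- frees the analysis of a single step from recursion on subtrees.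
    record Decomposition {T : Cotree n} (u : Inner T) : Set where
      field
        {k}         : ℕ
        part        : Fin (2 + k) → Subset n
        composition : IsComposition (label u) G (leavesBelow u) part
        child       : ∀ i → Child u (part i)
        descendant  : ∀ {v} → v ≺ u → ∃[ i ] leavesBelow v ⊆ part i

      partition : IsPartition (leavesBelow u) part
      partition = proj₁ composition

      partOf : ∀ {x} → x ∈ leavesBelow u → ∃[ i ] x ∈ part i
      partOf = to (proj₁ partition _)

    open Decomposition public

    leaves-nonempty : ∀ T → Explains T G → Nonempty (leaves T)
    leaves-nonempty (leaf x)    _           = x , x∈⁅x⁆ x
    leaves-nonempty (node _ ts) (comp , ex) =
      let x , p = leaves-nonempty (ts zero) (ex zero) in x , parts⊆ {G = G} (proj₁ comp) zero p

    leavesBelow-nonempty : ∀ {T} → Explains T G → (u : Inner T) → Nonempty (leavesBelow u)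
    leavesBelow-nonempty ex          here        = leaves-nonempty _ ex
    leavesBelow-nonempty (_ , ex)    (there i u) = leavesBelow-nonempty (ex i) u

    leavesBelow⊆leaves : ∀ {T} → Explains T G → (u : Inner T) → leavesBelow u ⊆ leaves T
    leavesBelow⊆leaves ex          here        p = p
    leavesBelow⊆leaves (comp , ex) (there i u) p =
      parts⊆ {G = G} (proj₁ comp) i (leavesBelow⊆leaves (ex i) u p)

    position : ∀ {T} → Explains T G → (u v : Inner T) → Position u v
    position ex here here = same refl
    position ex here (there i v) = above there≺here
    position ex (there i u) here = below there≺here
    position (comp , ex) (there i u) (there j v) with i ≟ᶠ j
    ... | no i≢j = disjoint λ p q → i≢j (proj₂ (proj₁ comp)
                     (leavesBelow⊆leaves (ex i) u p) (leavesBelow⊆leaves (ex j) v q))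
    ... | yes refl with position (ex i) u v
    ... | same refl  = same refl
    ... | below p    = below (there≺there p)
    ... | above p    = above (there≺there p)
    ... | disjoint d = disjoint d

    decomposition : ∀ {T} → Explains T G → Alternating T → (u : Inner T) → Decomposition u
    decomposition {node t ts} (comp , ex) alt here = record
      { part        = λ i → leaves (ts i)
      ; composition = comp
      ; child       = rootChild
      ; descendant  = λ { (there≺here {i = i} {u}) → i , leavesBelow⊆leaves (ex i) u }
      }
      where
      rootChild : ∀ i → Child {node t ts} here (leaves (ts i))
      rootChild i with root (ts i)
      ... | inj₁ (x , eq)       = leaf x eq
      ... | inj₂ (v , eq , lab) = inner (there i v) there≺here (sym eq)
        λ eq′ → proj₁ (alt i) (trans lab (cong just eq′))
    decomposition {node t ts} (_ , ex) alt (there i u) = record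
      { part        = part d
      ; composition = composition d
      ; child       = λ j → lift (child d j)
      ; descendant  = λ { (there≺there p) → descendant d p }
      }
      where
      d = decomposition (ex i) (proj₂ (alt i)) u

      lift : ∀ {C} → Child u C → Child (there {t = t} {ts = ts} i u) C
      lift (leaf x eq)        = leaf x eq
      lift (inner v p eq lab) = inner (there i v) (there≺there p) eq lab

    -- Two vertices of the same part are linked by a walk of length two through another part.
    join-connected : ∀ {k U} {P : Fin (2 + k) → Subset n} → IsComposition join G U P →
      (∀ i → Nonempty (P i)) → ∀ {x y} → x ∈ U → y ∈ U → Reachable G U x y
    join-connected {U = U} {P} comp@((cover , _) , cross) ne p q
      with to (cover _) p | to (cover _) q
    ... | i , p′ | j , q′ with i ≟ᶠ j
    ... | no i≢j = (p , q , cross i≢j p′ q′) ◅ ε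
    ... | yes refl with another i
    ... | l , i≢l with ne l
    ... | z , r = (p , r′ , cross i≢l p′ r) ◅ (r′ , q , cross (i≢l ∘ sym) r q′) ◅ ε
      where
      r′ : z ∈ U
      r′ = parts⊆ {G = G} (proj₁ comp) l r

-- Bottom-up orders

  -- Bundles distinctness and order, so that one induction on the tree yields both pairwise
  -- conditions of `IsBottomUp`.
  Before : ∀ {T : Cotree n} → Inner T → Inner T → Set
  Before u v = u ≢ v × ¬ (v ≺ u)

  postorder : ∀ (T : Cotree n) → List (Inner T)
  postorder (leaf _)    = []
  postorder (node t ts) = concat (tabulate λ i → map (there i) (postorder (ts i))) ++ here ∷ []

  ∈-postorder : ∀ {T : Cotree n} (u : Inner T) → u List.∈ postorder T
  ∈-postorder {node t ts} here =
    ∈-++⁺ʳ (concat (tabulate λ i → map (there i) (postorder (ts i)))) (here refl)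
  ∈-postorder {node t ts} (there i u) =
    ∈-++⁺ˡ (∈-concat⁺′ (∈-map⁺ (there i) (∈-postorder u))
                       (∈-tabulate⁺ {f = λ i → map (there i) (postorder (ts i))} i))

  postorder-before : ∀ (T : Cotree n) → AllPairs Before (postorder T)
  postorder-before (leaf _)    = []
  postorder-before (node t ts) = AllPairs.++⁺
    (AllPairs.concat⁺ (All.tabulate⁺ {f = block} block-before)
                      (AllPairs.tabulate⁺ {f = block} blocks-before))
    ([] ∷ [])
    (All.concat⁺ (All.tabulate⁺ {f = block} block-before-here))
    where
    block : ∀ i → List (Inner (node t ts))
    block i = map (there i) (postorder (ts i))

    within : ∀ {i} {u v : Inner (ts i)} → Before u v →
             Before (there {t = t} {ts = ts} i u) (there i v)
    within (u≢v , v⊀u) = (λ { refl → u≢v refl }) , λ { (there≺there p) → v⊀u p }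

    across : ∀ {i j} {u : Inner (ts i)} {v : Inner (ts j)} → i ≢ j →
             Before (there {t = t} {ts = ts} i u) (there j v)
    across i≢j = (λ { refl → i≢j refl }) , λ { (there≺there p) → i≢j refl }

    block-before : ∀ i → AllPairs Before (block i)
    block-before i = AllPairs.map⁺ (AllPairs.map within (postorder-before (ts i)))

    blocks-before : ∀ {i j} → i ≢ j → All (λ u → All (Before u) (block j)) (block i)
    blocks-before {i} {j} i≢j = All.map⁺ (All.universal
      (λ u → All.map⁺ (All.universal (λ v → across i≢j) (postorder (ts j)))) (postorder (ts i)))

    block-before-here : ∀ i → All (λ u → All (Before u) (here ∷ [])) (block i)
    block-before-here i =
      All.map⁺ (All.universal (λ u → ((λ ()) , λ ()) ∷ []) (postorder (ts i)))

  -- Supplies the traversal for the converse direction, where an output has to be exhibited.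
  postorder-bottomUp : ∀ (T : Cotree n) → IsBottomUp T (postorder T)
  postorder-bottomUp T = record
    { complete = ∈-postorder
    ; unique   = AllPairs.map proj₁ (postorder-before T)
    ; ordered  = AllPairs.map proj₂ (postorder-before T)
    }

  -- What a bottom-up order guarantees at the moment when `u` is reached and exactly `us` has been
  -- processed.
  record Ready {T : Cotree n} (us : List (Inner T)) (u : Inner T) : Set where
    field
      descendants : ∀ {v} → v ≺ u → v List.∈ us
      earlier     : ∀ {v} → v List.∈ us → Before v u

  open Ready

  bottomUp-ready : ∀ {T : Cotree n} us {u : Inner T} {vs} → IsBottomUp T (us ++ u ∷ vs) → Ready us u
  bottomUp-ready us {u} {vs} bu = record { descendants = desc ; earlier = early }
    where
    open IsBottomUp bu
    desc : ∀ {v} → v ≺ u → v List.∈ us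
    desc {v} v≺u with ∈-++⁻ us (complete v)
    ... | inj₁ p           = p
    ... | inj₂ (here refl) = contradiction v≺u ≺-irrefl
    ... | inj₂ (there p)   = contradiction v≺u (proj₂ (allPairs-++ us ordered) p)

    early : ∀ {v} → v List.∈ us → Before v u
    early p = proj₁ (allPairs-++ us unique) p , proj₁ (allPairs-++ us ordered) p

-- Invariants of the procedure

  module Procedure {G : Graph n} {T : Cotree n} (ex : Explains T G) (alt : Alternating T) where

    decomp : (u : Inner T) → Decomposition {G} u
    decomp = decomposition ex alt

    part-nonempty : ∀ u i → Nonempty (part (decomp u) i)
    part-nonempty u i with child (decomp u) i
    ... | leaf x eq        = subst Nonempty (sym eq) (x , x∈⁅x⁆ x)
    ... | inner v _ eq _ = subst Nonempty (sym eq) (leavesBelow-nonempty ex v)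

    part-indecomposable : ∀ u i → Indecomposable {G} (label u) (part (decomp u) i)
    part-indecomposable u i with child (decomp u) i
    ... | leaf x eq          = subst (Indecomposable {G} (label u)) (sym eq)
      (singleton-indecomposable {t = label u} x)
    ... | inner v _ eq lab = subst (Indecomposable {G} (label u)) (sym eq)
      (composition-indecomposable {t = label u} {label v} (composition (decomp v)) (part-nonempty v) (lab ∘ sym))

    -- The label is passed as a variable with an equation to `label v`, so that it can be matched by
    -- constructor patterns; later statements use the same form.
    node-connected : ∀ v {t} → t ≡ label v → t ≢ union → ∀ {x y} →
                     x ∈ leavesBelow v → y ∈ leavesBelow v → Reachable G (leavesBelow v) x y
    node-connected v {union} _  ≢union = contradiction refl ≢union
    node-connected v {join}  eq _      = join-connected {G = G}
      (subst (λ t → IsComposition t G (leavesBelow v) (part (decomp v))) (sym eq)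
             (composition (decomp v)))
      (part-nonempty v)

    part-connected : ∀ u → label u ≡ union → ∀ i {x y} → x ∈ part (decomp u) i →
                     y ∈ part (decomp u) i → Reachable G (part (decomp u) i) x y
    part-connected u lab i with child (decomp u) i
    ... | leaf z eq = subst (λ C → ∀ {x y} → x ∈ C → y ∈ C → Reachable G C x y) (sym eq)
      λ p q → subst (Reachable G ⁅ z ⁆ _) (trans (x∈⁅y⁆⇒x≡y z p) (sym (x∈⁅y⁆⇒x≡y z q))) ε
    ... | inner v _ eq lab′ = subst (λ C → ∀ {x y} → x ∈ C → y ∈ C → Reachable G C x y) (sym eq)
      (node-connected v refl (λ eq′ → lab′ (trans eq′ (sym lab))))

    composition-as : ∀ u {t} → t ≡ label u → IsComposition t G (leavesBelow u) (part (decomp u))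
    composition-as u refl = composition (decomp u)

    module UnionNode (u : Inner T) (lab : union ≡ label u) =
      Components {G} (composition-as u lab) (part-nonempty u) (part-connected u (sym lab))

    part⊆ : ∀ u i → part (decomp u) i ⊆ leavesBelow u
    part⊆ u = parts⊆ {G = G} (partition (decomp u))

    below⊆ : ∀ {u v} → v ≺ u → leavesBelow v ⊆ leavesBelow u
    below⊆ {u} v≺u p = let i , q = descendant (decomp u) v≺u in part⊆ u i (q p)

    module Step {us : List (Inner T)} {u : Inner T} (ready : Ready us u) where

      below-or-disjoint : ∀ {v} → v List.∈ us →
        v ≺ u ⊎ (∀ {x} → x ∈ leavesBelow v → x ∉ leavesBelow u)
      below-or-disjoint {v} p with position ex v u
      ... | same eq    = contradiction eq (proj₁ (earlier ready p))
      ... | below q    = inj₁ q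
      ... | above q    = contradiction q (proj₂ (earlier ready p))
      ... | disjoint d = inj₂ d

      process-classes-part : ∀ {t ρ τ} → t ≡ label u → Process G t (leavesBelow u) ρ τ →
                             ∀ i → SameClasses ρ τ (part (decomp u) i)
      process-classes-part {union} lab (_ , _ , r) = UnionNode.recoloring-classes u lab r
      process-classes-part {join}  _   e _         = ≗⇒sameClasses λ _ → sym (e _)

      process-outside : ∀ {t ρ τ} → Process G t (leavesBelow u) ρ τ →
                        ∀ {x} → x ∉ leavesBelow u → τ x ≡ ρ x
      process-outside {union} (_ , _ , r) = Recoloring.unchanged r
      process-outside {join}  e _         = e _

      process-within : ∀ {t ρ τ} → t ≡ label u → Process G t (leavesBelow u) ρ τ →
                       ∀ {x} → x ∈ leavesBelow u → ∃[ y ] y ∈ leavesBelow u × τ x ≡ ρ y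
      process-within {union} lab (_ , (c* , _) , r) p with UnionNode.component-part u lab c*
      ... | i , refl = let y , y∈ , eq = UnionNode.recoloring-image u lab r p in
                       y , part⊆ u i y∈ , eq
      process-within {join}  _   e p = _ , p , e _

      -- An earlier vertex lies within one part of `u` or is disjoint from `u`; on a part the step
      -- renames colors injectively, and off `u` it changes nothing.
      process-classes : ∀ {ρ τ} → Process G (label u) (leavesBelow u) ρ τ →
                        ∀ {v} → v List.∈ us → SameClasses ρ τ (leavesBelow v)
      process-classes {ρ} {τ} pr {v} p with below-or-disjoint p
      ... | inj₁ v≺u = let i , q = descendant (decomp u) v≺u in
        sameClasses-⊆ {ρ} {τ} q (process-classes-part refl pr i)
      ... | inj₂ d   = ≗⇒sameClasses λ q → sym (process-outside {label u} pr (d q))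

    -- Injectivity of the initial coloring, relaxed exactly below the vertices already processed.
    Separated : List (Inner T) → Coloring n → Set
    Separated us ρ = ∀ {x y} → ρ x ≡ ρ y →
      x ≡ y ⊎ (∃[ u ] u List.∈ us × x ∈ leavesBelow u × y ∈ leavesBelow u)

    injective⇒separated : ∀ {us σ} → Injective _≡_ _≡_ σ → Separated us σ
    injective⇒separated inj eq = inj₁ (inj eq)

    module _ {us : List (Inner T)} {u : Inner T} (ready : Ready us u) where

      open Step ready

      -- The step gives vertices of `u` only colors that already occurred there. A color shared
      -- across the border of `u` would have been shared before, below an earlier vertex; but such a
      -- vertex lies entirely inside or entirely outside `u`.
      boundary : ∀ {ρ τ} → Process G (label u) (leavesBelow u) ρ τ → Separated us ρ →
                 ∀ {x y} → x ∈ leavesBelow u → y ∉ leavesBelow u → τ x ≢ τ y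
      boundary pr sep p ¬q eq with process-within refl pr p
      ... | z , z∈ , eq′ with sep (trans (sym eq′) (trans eq (process-outside {label u} pr ¬q)))
      ... | inj₁ refl = ¬q z∈
      ... | inj₂ (v , v∈ , r , s) with below-or-disjoint v∈
      ... | inj₁ v≺u = ¬q (below⊆ v≺u s)
      ... | inj₂ d   = d r z∈

      process-separated : ∀ {ρ τ} → Process G (label u) (leavesBelow u) ρ τ →
                          Separated us ρ → Separated (us ∷ʳ u) τ
      process-separated {ρ} {τ} pr sep {x} {y} eq with x ∈? leavesBelow u | y ∈? leavesBelow u
      ... | yes p | yes q = inj₂ (u , ∈-++⁺ʳ us (here refl) , p , q)
      ... | yes p | no ¬q = contradiction eq (boundary pr sep p ¬q)
      ... | no ¬p | yes q = contradiction (sym eq) (boundary pr sep q ¬p)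
      ... | no ¬p | no ¬q
        with sep (trans (sym (process-outside {label u} pr ¬p)) (trans eq (process-outside {label u} pr ¬q)))
      ... | inj₁ x≡y               = inj₁ x≡y
      ... | inj₂ (v , v∈ , r , s) = inj₂ (v , ∈-++⁺ˡ v∈ , r , s)

      -- An earlier vertex above both `x` and `y` meets `u`, so it is a descendant of `u` and
      -- thereby confined to one part.
      separated-parts : ∀ {ρ} → Separated us ρ → ∀ {i j x y} → i ≢ j →
        x ∈ part (decomp u) i → y ∈ part (decomp u) j → ρ x ≢ ρ y
      separated-parts sep {i} {j} i≢j p q eq with sep eq
      ... | inj₁ refl = i≢j (proj₂ (partition (decomp u)) p q)
      ... | inj₂ (v , v∈ , r , s) with below-or-disjoint v∈
      ... | inj₂ d   = d r (part⊆ u i p)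
      ... | inj₁ v≺u with descendant (decomp u) v≺u
      ... | l , v⊆l  = i≢j (trans (proj₂ (partition (decomp u)) p (v⊆l r))
                                  (proj₂ (partition (decomp u)) (v⊆l s) q))

      process-colorMinimal : ∀ {t ρ τ} → t ≡ label u → Process G t (leavesBelow u) ρ τ →
        Separated us ρ → (∀ i → IsColorMinimalOn G τ (part (decomp u) i)) →
        IsColorMinimalOn G τ (leavesBelow u)
      process-colorMinimal {union} {ρ} {τ} lab (C* , (c* , _) , r) _ min
        with UnionNode.component-part u lab c*
      ... | i* , refl = compose
        (union-optimal {G = G} (composition-as u lab) (λ i → colorMinimal⇒optimal (min i)) i*
          λ p → let y , y∈ , eq = UnionNode.recoloring-image u lab r p in
                y , y∈ , trans eq (sym (Recoloring.unchanged* r y∈)))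
        union _ (composition-as u lab) min
      process-colorMinimal {join} lab e sep min = compose
        (join-optimal {G = G} (composition-as u lab) (λ i → colorMinimal⇒optimal (min i))
          λ i≢j p q eq → separated-parts sep i≢j p q (trans (sym (e _)) (trans eq (e _))))
        join _ (composition-as u lab) min

    record Invariant (us : List (Inner T)) (ρ : Coloring n) : Set where
      field
        separated : Separated us ρ
        minimal   : ∀ {u} → u List.∈ us → IsColorMinimalOn G ρ (leavesBelow u)

    open Invariant

    parts-colorMinimal : ∀ {us u ρ} → Ready us u → Invariant us ρ →
                         ∀ i → IsColorMinimalOn G ρ (part (decomp u) i)
    parts-colorMinimal {u = u} {ρ} ready inv i with child (decomp u) i
    ... | leaf x eq        = singleton-colorMinimal ρ x eq
    ... | inner v p eq _ = subst (IsColorMinimalOn G ρ) (sym eq) (minimal inv (descendants ready p))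

    invariant-step : ∀ {us u ρ τ} → Ready us u → Process G (label u) (leavesBelow u) ρ τ →
                     Invariant us ρ → Invariant (us ∷ʳ u) τ
    invariant-step {us} {u} {ρ} {τ} ready pr inv = record
      { separated = process-separated ready pr (separated inv)
      ; minimal   = min
      }
      where
      open Step ready
      min : ∀ {v} → v List.∈ us ∷ʳ u → IsColorMinimalOn G τ (leavesBelow v)
      min p with ∈-++⁻ us p
      ... | inj₁ q           = sameClasses-colorMinimal (process-classes pr q) (minimal inv q)
      ... | inj₂ (here refl) = process-colorMinimal ready refl pr (separated inv) λ i →
        sameClasses-colorMinimal (process-classes-part refl pr i) (parts-colorMinimal ready inv i)

    -- The run may end before the traversal does, with `vs` still to be processed; this is the
    -- situation in `neverStuck`.
    run-invariant : ∀ us {ws vs ρ τ} → IsBottomUp T (us ++ ws ++ vs) → Invariant us ρ →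
                    Run G ρ ws τ → Invariant (us ++ ws) τ
    run-invariant us bu inv [] = subst (λ l → Invariant l _) (sym (++-identityʳ us)) inv
    run-invariant us {u ∷ ws} {vs} bu inv (pr ∷ r) = subst (λ l → Invariant l _) (∷ʳ-++ us u ws)
      (run-invariant (us ∷ʳ u) {vs = vs} (subst (IsBottomUp T) (sym (∷ʳ-++ us u (ws ++ vs))) bu)
        (invariant-step (bottomUp-ready us bu) pr inv) r)

    initial-invariant : ∀ {σ} → Injective _≡_ _≡_ σ → Invariant [] σ
    initial-invariant inj = record { separated = injective⇒separated inj ; minimal = λ () }

    canProcess-step : ∀ {us u ρ} → Ready us u → Invariant us ρ → ∀ {t} → t ≡ label u →
                      CanProcess G t (leavesBelow u) ρ
    canProcess-step {u = u} ready inv {union} lab =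
      UnionNode.canProcess u lab λ i → colorMinimal⇒optimal (parts-colorMinimal ready inv i)
    canProcess-step ready inv {join} lab = _

    neverStuck : NeverStuck G T
    neverStuck us u vs inj bu r = canProcess-step (bottomUp-ready us bu)
      (run-invariant [] {us} {u ∷ vs} bu (initial-invariant inj) r) refl

    output-colorMinimal : ∀ {τ} → IsOutput G T τ → IsColorMinimalOn G τ (leaves T)
    output-colorMinimal {τ} (σ , us , inj , bu , r) with root T
    ... | inj₁ (x , eq)     = singleton-colorMinimal τ x eq
    ... | inj₂ (v , eq , _) = subst (IsColorMinimalOn G τ) eq
      (minimal (run-invariant [] {us} {[]} (subst (IsBottomUp T) (sym (++-identityʳ us)) bu)
        (initial-invariant inj) r) (IsBottomUp.complete bu v))

    -- The part is indecomposable for the label of `u`, so it can be located inside whatever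
    -- decompositions establish the minimality of `σ`.
    parts-minimal : ∀ {σ} u → IsColorMinimalOn G σ (leavesBelow u) →
                    ∀ i → IsColorMinimalOn G σ (part (decomp u) i)
    parts-minimal u m i = colorMinimal-component {t = label u} m (part⊆ u i) (part-nonempty u i)
      (part-indecomposable u i) across
      where
      across : ∀ {x y} → x ∈ part (decomp u) i → y ∈ leavesBelow u → y ∉ part (decomp u) i →
               CrossEdge {G} (label u) x y
      across p q ¬r with partOf (decomp u) q
      ... | j , r = crossEdge (label u) (proj₂ (composition (decomp u))) (λ { refl → ¬r r }) p r

    -- Reproducing a recursively minimal coloring

    module Following {σ : Coloring n}
      (σ-min : ∀ (u : Inner T) → IsColorMinimalOn G σ (leavesBelow u)) where

      -- Only classes are compared with `σ`; its actual colors are restored at the end of the run by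
      -- a renaming.
      record Follows (us : List (Inner T)) (ρ : Coloring n) : Set where
        field
          separated : Separated us ρ
          classes   : ∀ {u} → u List.∈ us → SameClasses σ ρ (leavesBelow u)

      open Follows

      parts-classes : ∀ {us u ρ} → Ready us u → Follows us ρ →
                      ∀ i → SameClasses σ ρ (part (decomp u) i)
      parts-classes {u = u} {ρ} ready f i with child (decomp u) i
      ... | leaf x eq        = subst (SameClasses σ ρ) (sym eq) λ p q →
        let x≡y = trans (x∈⁅y⁆⇒x≡y x p) (sym (x∈⁅y⁆⇒x≡y x q)) in
        mk⇔ (λ _ → cong ρ x≡y) (λ _ → cong σ x≡y)
      ... | inner v p eq _ = subst (SameClasses σ ρ) (sym eq) (classes f (descendants ready p))

      -- At a union, a maximal component on which all colors of `σ` below `u` occur is chosen as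
      -- `G*`, and `recoloring-following` merges the colors accordingly.
      follow : ∀ {us u ρ} → Ready us u → Follows us ρ → ∀ {t} → t ≡ label u →
        ∃[ τ ] Process G t (leavesBelow u) ρ τ × SameClasses σ τ (leavesBelow u)
      follow {us} {u} {ρ} ready f {union} lab
        with UnionNode.optimal⇒same-colors u lab
               (λ i → colorMinimal⇒optimal (parts-minimal u (σ-min u) i))
               (colorMinimal⇒optimal (σ-min u))
      ... | i* , max , same-colors
        with UnionNode.recoloring-following u lab {i*} {σ} {ρ} (parts-classes ready f) same-colors
      ... | τ , r , followed = τ , (_ , max , r) , followed
      follow {us} {u} {ρ} ready f {join} lab = ρ , (λ _ → refl) , same-classes
        where
        same-classes : SameClasses σ ρ (leavesBelow u)
        same-classes p q with partOf (decomp u) p | partOf (decomp u) q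
        ... | i , p′ | j , q′ with i ≟ᶠ j
        ... | yes refl = parts-classes ready f i p′ q′
        -- No class of either coloring meets two parts of a join: `σ` is proper, and `ρ` is
        -- separated.
        ... | no i≢j   = mk⇔
          (λ eq → contradiction eq
            (proj₁ (colorMinimal⇒optimal (σ-min u)) p q (proj₂ (composition-as u lab) i≢j p′ q′)))
          (λ eq → contradiction eq (separated-parts ready (separated f) i≢j p′ q′))

      follow-step : ∀ {us u ρ τ} → Ready us u → Process G (label u) (leavesBelow u) ρ τ →
        SameClasses σ τ (leavesBelow u) → Follows us ρ → Follows (us ∷ʳ u) τ
      follow-step {us} {u} {ρ} {τ} ready pr same-classes f = record
        { separated = process-separated ready pr (separated f)
        ; classes   = cls
        }
        where
        cls : ∀ {v} → v List.∈ us ∷ʳ u → SameClasses σ τ (leavesBelow v)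
        cls p with ∈-++⁻ us p
        ... | inj₁ q           = sameClasses-trans (classes f q) (Step.process-classes ready pr q)
        ... | inj₂ (here refl) = same-classes

      follow-run : ∀ us {ws ρ} → IsBottomUp T (us ++ ws) → Follows us ρ →
                   ∃[ τ ] Run G ρ ws τ × Follows (us ++ ws) τ
      follow-run us {[]} bu f = _ , [] , subst (λ l → Follows l _) (sym (++-identityʳ us)) f
      follow-run us {u ∷ ws} bu f with follow (bottomUp-ready us bu) f refl
      ... | ρ′ , pr , same-classes
        with follow-run (us ∷ʳ u) (subst (IsBottomUp T) (sym (∷ʳ-++ us u ws)) bu)
               (follow-step (bottomUp-ready us bu) pr same-classes f)
      ... | τ , r , f′ = τ , pr ∷ r , subst (λ l → Follows l τ) (∷ʳ-++ us u ws) f′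

      -- The run is first made from the coloring `toℕ` and then renamed as a whole, which keeps its
      -- start injective. The existence of `v` rules out an empty traversal.
      reached : ∀ {us} → IsBottomUp T us → (v : Inner T) → leavesBelow v ≡ ⊤ → IsOutput G T σ
      reached {[]}     bu v _ with IsBottomUp.complete bu v
      ... | ()
      reached {u ∷ us} bu v eq
        with follow-run [] bu (record { separated = injective⇒separated toℕ-injective ; classes = λ () })
      ... | τ , r , f
        with renaming-exists (subst (SameClasses σ τ) eq (classes f (IsBottomUp.complete bu v)))
      ... | π , π-inj , π∘τ≗σ =
        π ∘ toℕ , u ∷ us , toℕ-injective ∘ π-inj , bu , run-≗ (run-rename π-inj r) π∘τ≗σ

  -- Minimality passes from the root to its parts, and then recursively down each subtree.
  colorMinimal-below : ∀ {G : Graph n} {σ T} → Explains T G → Alternating T →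
    IsColorMinimalOn G σ (leaves T) → (u : Inner T) → IsColorMinimalOn G σ (leavesBelow u)
  colorMinimal-below ex alt m here = m
  colorMinimal-below {T = node t ts} (comp , ex) alt m (there i u) = colorMinimal-below (ex i) (proj₂ (alt i))
    (Procedure.parts-minimal (comp , ex) alt here m i) u

  colorMinimal-output : ∀ {G : Graph n} {σ} T → IsDiscriminatingCotree G T →
                        IsRecursivelyMinimal G σ → IsOutput G T σ
  -- On a single vertex `σ` is injective and is itself the initial coloring of an empty run.
  colorMinimal-output {G} {σ} (leaf x) ((⊤≡ , _) , _) _ = σ , [] , inj , postorder-bottomUp (leaf x) , []
    where
    all-x : ∀ y → y ≡ x
    all-x y = x∈⁅y⁆⇒x≡y x (subst (y ∈_) (sym ⊤≡) ∈⊤)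

    inj : Injective _≡_ _≡_ σ
    inj {y} {z} _ = trans (all-x y) (sym (all-x z))
  colorMinimal-output {G} {σ} T@(node _ _) ((⊤≡ , ex) , alt) m =
    Procedure.Following.reached ex alt
      (colorMinimal-below ex alt (subst (IsColorMinimalOn G σ) (sym ⊤≡) m))
      (postorder-bottomUp T) here ⊤≡

theorem10 : ∀ {n : ℕ} (G : Graph n) → IsCograph G →
    (T : Cotree n) → IsDiscriminatingCotree G T →
    NeverStuck G T
    × (∀ σ → IsOutput G T σ → IsRecursivelyMinimal G σ)
    × (∀ σ → IsRecursivelyMinimal G σ → IsOutput G T σ)
theorem10 G _ T disc@((⊤≡ , ex) , alt) =
    Procedure.neverStuck ex alt
  , (λ σ out → subst (IsColorMinimalOn G σ) ⊤≡ (Procedure.output-colorMinimal ex alt out))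
  , (λ σ → colorMinimal-output T disc)
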